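{- For every fixed positive integer $d$, let $f_d(n)$ be the largest integer such that every poset on $n$ elements has a subposet on $f_d(n)$ elements of dimension at most $d$. Then \[ f_d(n) = O\left(n^{\frac{d}{d+1}}\right) \quad (n\to\infty), \] where the implied constant may depend on $d$.
   Context: A subposet of a poset $P$ is a subset of its ground set with the order induced from $P$. The dimension of a poset $P$ is the least integer $d$ such that there are $d$ linear extensions of $P$ whose intersection is $P$ (equivalently, the least $d$ such that $P$ embeds into $\mathbb{R}^d$ with the coordinatewise product order). -}

module Defs where

open import Data.Fin using (Fin; combine; remQuot)
open import Data.Fin.Properties using (all?; remQuot-combine) renaming (_≟_ to _≟ᶠ_; ≤-isDecTotalOrder to ≤ᶠ-isDecTotalOrder)
open import Data.Fin.Subset using (Subset; _∈_; ∣_∣; ⊥)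
open import Data.Fin.Subset.Properties using (_∈?_; anySubset?; ∉⊥; ∣⊥∣≡0; ∣p∣≤n)
open import Data.Nat using (ℕ; zero; suc; _*_; _^_; _≤_; z≤n; NonZero)
open import Data.Nat.Properties using (≤-refl; ≤-pred; ≤∧≢⇒<; ≰⇒>; m≤n⇒m≤1+n) renaming (_≟_ to _≟ⁿ_)
open import Data.Product using (∃; Σ; _×_; _,_; proj₁; proj₂; uncurry)
open import Data.Sum as Sum using (_⊎_; inj₁; inj₂)
open import Data.Unit using (⊤)
open import Data.Vec using (tabulate)
open import Data.Vec.Properties using (lookup∘tabulate; lookup⇒[]=; []=⇒lookup)
open import Data.Vec.Properties.WithK using ([]=-irrelevant)
open import Function using (_∘_; _⇔_; mk⇔; Equivalence)
open import Level using (Level; 0ℓ)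
open import Relation.Binary using (Rel; _⇒_; Poset; IsPartialOrder; IsTotalOrder; IsDecPartialOrder; IsEquivalence; IsDecTotalOrder) renaming (Decidable to Decidable₂)
open import Relation.Binary.Consequences using (total∧dec⇒dec)
import Relation.Binary.Construct.On as On
open import Relation.Binary.PropositionalEquality using (_≡_; refl; sym; trans; subst; isEquivalence)
open import Relation.Nullary using (¬_; Dec; yes; no; does; contradiction)
open import Relation.Nullary.Decidable using (map′; _×-dec_; _⊎-dec_; _→-dec_; ¬?; decidable-stable; dec-true)
open import Relation.Unary using (Pred; Decidable)

private
  variable
    ℓ : Level
    n : ℕ

IsLeast : Pred ℕ ℓ → Pred ℕ ℓ
IsLeast Q k = Q k × (∀ j → Q j → k ≤ j)

IsLargest : Pred ℕ ℓ → Pred ℕ ℓ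
IsLargest Q m = Q m × (∀ j → Q j → j ≤ m)

record IsLinearExtension (P : Poset 0ℓ 0ℓ 0ℓ) (L : Rel (Poset.Carrier P) 0ℓ) : Set where
  field
    isTotalOrder : IsTotalOrder (Poset._≈_ P) L
    extends      : Poset._≤_ P ⇒ L

-- k linear extensions whose intersection is P.  For k = 0 the
-- intersection is the full relation, so only posets with at most one
-- element have an empty realizer.
HasRealizer : Poset 0ℓ 0ℓ 0ℓ → ℕ → Set₁
HasRealizer P k =
  Σ (Fin k → Rel P.Carrier 0ℓ) λ L →
    (∀ i → IsLinearExtension P (L i)) ×
    (∀ x y → x P.≤ y ⇔ (∀ i → L i x y))
  where module P = Poset P

HasDimension : Poset 0ℓ 0ℓ 0ℓ → ℕ → Set₁
HasDimension P = IsLeast (HasRealizer P)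

DimensionAtMost : ℕ → Poset 0ℓ 0ℓ 0ℓ → Set₁
DimensionAtMost d P = ∃ λ k → HasDimension P k × k ≤ d

-- Ground set Fin n, without loss of generality.  Decidability of the
-- order, automatic classically, only narrows the class of posets that
-- can witness an upper bound on f.
record FinPoset (n : ℕ) : Set₁ where
  field
    _⊑_               : Rel (Fin n) 0ℓ
    isDecPartialOrder : IsDecPartialOrder _≡_ _⊑_

  poset : Poset 0ℓ 0ℓ 0ℓ
  poset = record { isPartialOrder = IsDecPartialOrder.isPartialOrder isDecPartialOrder }

subposet : FinPoset n → Subset n → Poset 0ℓ 0ℓ 0ℓ
subposet P S = On.poset (FinPoset.poset P) (proj₁ {B = _∈ S})

Guaranteed : (d n m : ℕ) → Set₁
Guaranteed d n m =
  (P : FinPoset n) → ∃ λ (S : Subset n) → ∣ S ∣ ≡ m × DimensionAtMost d (subposet P S)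

-- The private development below decides Guaranteed by finite search, so
-- that f can be defined outright; f-isLargest is its specification.

private
  leastUpTo : {Q : Pred ℕ ℓ} → Decidable Q → ∀ d →
              (∃ λ k → IsLeast Q k × k ≤ d) ⊎ (∀ k → k ≤ d → ¬ Q k)
  leastUpTo Q? zero with Q? zero
  ... | yes q = inj₁ (zero , (q , λ _ _ → z≤n) , z≤n)
  ... | no ¬q = inj₂ λ { zero _ → ¬q }
  leastUpTo Q? (suc d) with leastUpTo Q? d
  ... | inj₁ (k , l , k≤d) = inj₁ (k , l , m≤n⇒m≤1+n k≤d)
  ... | inj₂ none with Q? (suc d)
  ...   | yes q = inj₁ (suc d , (q , λ j qj → ≰⇒> λ j≤d → none j j≤d qj) , ≤-refl)
  ...   | no ¬q = inj₂ none′
    where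
    none′ : ∀ k → k ≤ suc d → ¬ _
    none′ k k≤ qk with k ≟ⁿ suc d
    ... | yes refl = ¬q qk
    ... | no  k≢   = none k (≤-pred (≤∧≢⇒< k≤ k≢)) qk

  largest : {Q : Pred ℕ ℓ} → Decidable Q → Q 0 → ∀ b → (∀ m → Q m → m ≤ b) → ∃ (IsLargest Q)
  largest Q? q₀ zero    bd = 0 , q₀ , bd
  largest Q? q₀ (suc b) bd with Q? (suc b)
  ... | yes q = suc b , q , bd
  ... | no ¬q = largest Q? q₀ b λ m qm →
    ≤-pred (≤∧≢⇒< (bd m qm) λ { refl → ¬q qm })

  allIn? : {S : Subset n} {Q : Pred (∃ (_∈ S)) ℓ} → Decidable Q → Dec (∀ u → Q u)
  allIn? {S = S} {Q} Q? = map′ uncurry (λ g x p → g (x , p)) (all? at)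
    where
    at : ∀ x → Dec (∀ p → Q (x , p))
    at x with x ∈? S
    ... | no x∉S = yes λ p → contradiction p x∉S
    ... | yes p  = map′ (λ q p′ → subst (λ p → Q (x , p)) ([]=-irrelevant p p′) q) (λ h → h p) (Q? (x , p))

  toSubset : {Q : Pred (Fin n) ℓ} → Decidable Q → Subset n
  toSubset Q? = tabulate (does ∘ Q?)

  ∈-toSubset : {Q : Pred (Fin n) ℓ} (Q? : Decidable Q) → ∀ x → x ∈ toSubset Q? ⇔ Q x
  ∈-toSubset {Q = Q} Q? x = mk⇔ to from
    where
    eq = lookup∘tabulate (does ∘ Q?) x
    to : x ∈ toSubset Q? → Q x
    to p with Q? x | trans (sym eq) ([]=⇒lookup p)
    ... | yes q | _ = q
    from : Q x → x ∈ toSubset Q?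
    from q = lookup⇒[]= x _ (trans eq (dec-true (Q? x) q))

  rel : Subset (n * n) → Rel (Fin n) 0ℓ
  rel M x y = combine x y ∈ M

  rel-surjective : {R : Rel (Fin n) ℓ} → Decidable₂ R → ∃ λ M → ∀ x y → rel M x y ⇔ R x y
  rel-surjective {n = n} {R = R} R? = toSubset Q? , λ x y →
    let open Equivalence (∈-toSubset Q? (combine x y)) in
    mk⇔ (subst (uncurry R) (remQuot-combine x y) ∘ to)
        (from ∘ subst (uncurry R) (sym (remQuot-combine x y)))
    where
    Q? : Decidable (uncurry R ∘ remQuot {n} n)
    Q? z = uncurry R? (remQuot {n} n z)

  module Search {A : Set} (∀? : ∀ {Q : Pred A 0ℓ} → Decidable Q → Dec (∀ x → Q x)) where

    isPartialOrder? : {_≈_ _∼_ : Rel A 0ℓ} → IsEquivalence _≈_ →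
                      Decidable₂ _≈_ → Decidable₂ _∼_ → Dec (IsPartialOrder _≈_ _∼_)
    isPartialOrder? isEq _≈?_ _∼?_ = map′
      (λ (r , t , a) → record
        { isPreorder = record
          { isEquivalence = isEq
          ; reflexive     = λ {x} {y} → r x y
          ; trans         = λ {x} {y} {z} → t x y z
          }
        ; antisym = λ {x} {y} → a x y
        })
      (λ po → let open IsPartialOrder po in
        (λ _ _ → reflexive) , (λ _ _ _ p q → IsPartialOrder.trans po p q) , (λ _ _ → antisym))
      ( ∀? (λ x → ∀? λ y → (x ≈? y) →-dec (x ∼? y))
      ×-dec ∀? (λ x → ∀? λ y → ∀? λ z → (x ∼? y) →-dec ((y ∼? z) →-dec (x ∼? z)))
      ×-dec ∀? (λ x → ∀? λ y → (x ∼? y) →-dec ((y ∼? x) →-dec (x ≈? y))))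

    isTotalOrder? : {_≈_ _∼_ : Rel A 0ℓ} → IsEquivalence _≈_ →
                    Decidable₂ _≈_ → Decidable₂ _∼_ → Dec (IsTotalOrder _≈_ _∼_)
    isTotalOrder? isEq _≈?_ _∼?_ = map′
      (λ (po , t) → record { isPartialOrder = po ; total = t })
      (λ o → IsTotalOrder.isPartialOrder o , IsTotalOrder.total o)
      (isPartialOrder? isEq _≈?_ _∼?_ ×-dec ∀? λ x → ∀? λ y → (x ∼? y) ⊎-dec (y ∼? x))

  IsTotalOrder-resp : {A : Set} {_≈_ R R′ : Rel A 0ℓ} → (∀ x y → R x y ⇔ R′ x y) →
                      IsTotalOrder _≈_ R → IsTotalOrder _≈_ R′
  IsTotalOrder-resp {R = R} {R′} R⇔R′ o = record
    { isPartialOrder = record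
      { isPreorder = record
        { isEquivalence = O.isEquivalence
        ; reflexive     = to ∘ O.reflexive
        ; trans         = λ p q → to (O.trans (from p) (from q))
        }
      ; antisym = λ p q → O.antisym (from p) (from q)
      }
    ; total = λ x y → Sum.map to to (O.total x y)
    }
    where
    module O = IsTotalOrder o
    to : ∀ {x y} → R x y → R′ x y
    to {x} {y} = Equivalence.to (R⇔R′ x y)
    from : ∀ {x y} → R′ x y → R x y
    from {x} {y} = Equivalence.from (R⇔R′ x y)

  module _ (P : FinPoset n) (S : Subset n) where
    open FinPoset P using (_⊑_; isDecPartialOrder)
    private
      module D = IsDecPartialOrder isDecPartialOrder
      module U = Poset (subposet P S)
      open Search {A = U.Carrier} allIn?

      _≈?_ : Decidable₂ U._≈_
      u ≈? v = proj₁ u ≟ᶠ proj₁ v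

      _≤ᵤ?_ : Decidable₂ U._≤_
      u ≤ᵤ? v = proj₁ u D.≤? proj₁ v

      restrict : Subset (n * n) → Rel U.Carrier 0ℓ
      restrict M u v = rel M (proj₁ u) (proj₁ v)

      restrict? : ∀ M → Decidable₂ (restrict M)
      restrict? M u v = combine (proj₁ u) (proj₁ v) ∈? M

      restrict-surjective : {L : Rel U.Carrier 0ℓ} → Decidable₂ L → ∃ λ M → ∀ u v → restrict M u v ⇔ L u v
      restrict-surjective {L} L? = proj₁ M , λ u v →
        let open Equivalence (proj₂ M (proj₁ u) (proj₁ v)) in
        mk⇔ (λ r → let (p , q , l) = to r in
                   subst (λ p → L (proj₁ u , p) v) ([]=-irrelevant p (proj₂ u))
                     (subst (λ q → L (proj₁ u , p) (proj₁ v , q)) ([]=-irrelevant q (proj₂ v)) l))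
            (λ l → from (proj₂ u , proj₂ v , l))
        where
        ext : Rel (Fin n) 0ℓ
        ext x y = Σ (x ∈ S) λ p → Σ (y ∈ S) λ q → L (x , p) (y , q)
        ext? : Decidable₂ ext
        ext? x y with x ∈? S | y ∈? S
        ... | no x∉S | _      = no (x∉S ∘ proj₁)
        ... | yes _  | no y∉S = no (y∉S ∘ proj₁ ∘ proj₂)
        ... | yes p  | yes q  = map′ (λ l → p , q , l)
          (λ (p′ , q′ , l) →
             subst (λ p → L (x , p) (y , q)) ([]=-irrelevant p′ p)
               (subst (λ q → L (x , p′) (y , q)) ([]=-irrelevant q′ q) l))
          (L? (x , p) (y , q))
        M = rel-surjective ext?

      isLinearExtension? : ∀ M → Dec (IsLinearExtension (subposet P S) (restrict M))
      isLinearExtension? M = map′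
        (λ (t , e) → record { isTotalOrder = t ; extends = λ {u} {v} → e u v })
        (λ l → IsLinearExtension.isTotalOrder l , λ u v → IsLinearExtension.extends l {u} {v})
        (isTotalOrder? U.isEquivalence _≈?_ (restrict? M)
         ×-dec allIn? λ u → allIn? λ v → (u ≤ᵤ? v) →-dec restrict? M u v)

      -- A realizer with k members is found by choosing the members one
      -- at a time; R is the intersection of those already chosen.
      Completes : (R : Rel U.Carrier 0ℓ) → ℕ → Set₁
      Completes R k =
        Σ (Fin k → Rel U.Carrier 0ℓ) λ L →
          (∀ i → IsLinearExtension (subposet P S) (L i)) ×
          (∀ u v → R u v → (∀ i → L i u v) → u U.≤ v)

      cons : {R : Rel U.Carrier 0ℓ} {k : ℕ} (M : Subset (n * n)) →
             IsLinearExtension (subposet P S) (restrict M) →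
             Completes (λ u v → R u v × restrict M u v) k → Completes R (suc k)
      cons M lin (L , lins , c) =
          (λ { Fin.zero → restrict M ; (Fin.suc i) → L i })
        , (λ { Fin.zero → lin ; (Fin.suc i) → lins i })
        , (λ u v r h → c u v (r , h Fin.zero) (h ∘ Fin.suc))

      uncons : {R : Rel U.Carrier 0ℓ} {k : ℕ} → Completes R (suc k) →
               ∃ λ M → IsLinearExtension (subposet P S) (restrict M) ×
                       Completes (λ u v → R u v × restrict M u v) k
      uncons (L , lins , c) =
          proj₁ M
        , record
          { isTotalOrder = IsTotalOrder-resp (λ u v → mk⇔ (M⇔.from u v) (M⇔.to u v)) T.isTotalOrder
          ; extends      = λ {u} {v} → M⇔.from u v ∘ T.extends
          }
        , L ∘ Fin.suc
        , lins ∘ Fin.suc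
        , (λ u v (r , m) h → c u v r λ { Fin.zero → M⇔.to u v m ; (Fin.suc i) → h i })
        where
        module T = IsLinearExtension (lins Fin.zero)
        module O = IsTotalOrder T.isTotalOrder
        M = restrict-surjective (total∧dec⇒dec O.reflexive O.antisym O.total _≈?_)
        module M⇔ u v = Equivalence (proj₂ M u v)

      completes? : ∀ {R} → Decidable₂ R → ∀ k → Dec (Completes R k)
      completes? R? zero = map′
        (λ c → (λ ()) , (λ ()) , λ u v r _ → c u v r)
        (λ (_ , _ , c) u v r → c u v r λ ())
        (allIn? λ u → allIn? λ v → R? u v →-dec (u ≤ᵤ? v))
      completes? R? (suc k) = map′
        (λ (M , lin , c) → cons M lin c)
        uncons
        (anySubset? λ M → isLinearExtension? M ×-dec completes? (λ u v → R? u v ×-dec restrict? M u v) k)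

      hasRealizer? : Decidable (HasRealizer (subposet P S))
      hasRealizer? k = map′
        (λ (L , lins , c) → L , lins , λ u v →
          mk⇔ (λ u≤v i → IsLinearExtension.extends (lins i) u≤v) (c u v _))
        (λ (L , lins , c) → L , lins , λ u v _ → Equivalence.from (c u v))
        (completes? {R = λ _ _ → ⊤} (λ _ _ → yes _) k)

    dimensionAtMost? : ∀ d → Dec (DimensionAtMost d (subposet P S))
    dimensionAtMost? d with leastUpTo hasRealizer? d
    ... | inj₁ found = yes found
    ... | inj₂ none  = no λ (k , (r , _) , k≤d) → none k k≤d r

  _≐_ : FinPoset n → FinPoset n → Set
  P ≐ Q = ∀ x y → FinPoset._⊑_ P x y ⇔ FinPoset._⊑_ Q x y

  ≐-sym : {P Q : FinPoset n} → P ≐ Q → Q ≐ P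
  ≐-sym e x y = let open Equivalence (e x y) in mk⇔ from to

  HasRealizer-resp : {P Q : FinPoset n} (S : Subset n) → P ≐ Q →
                     ∀ {k} → HasRealizer (subposet P S) k → HasRealizer (subposet Q S) k
  HasRealizer-resp S e (L , lins , c) =
      L
    , (λ i → record
        { isTotalOrder = IsLinearExtension.isTotalOrder (lins i)
        ; extends      = IsLinearExtension.extends (lins i) ∘ Equivalence.from (e _ _)
        })
    , (λ u v → mk⇔ (Equivalence.to (c u v) ∘ Equivalence.from (e _ _))
                   (Equivalence.to (e _ _) ∘ Equivalence.from (c u v)))

  DimensionAtMost-resp : {P Q : FinPoset n} (S : Subset n) → P ≐ Q →
                         ∀ {d} → DimensionAtMost d (subposet P S) → DimensionAtMost d (subposet Q S)
  DimensionAtMost-resp {P = P} {Q} S e (k , (r , least) , k≤d) =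
    k , (HasRealizer-resp {P = P} {Q} S e r
        , λ j → least j ∘ HasRealizer-resp {P = Q} {P} S (≐-sym {P = P} {Q} e)) , k≤d

  guaranteed? : ∀ d n → Decidable (Guaranteed d n)
  guaranteed? d n m = map′ to from (¬? (anySubset? bad?))
    where
    Good : FinPoset n → Set₁
    Good P = ∃ λ (S : Subset n) → ∣ S ∣ ≡ m × DimensionAtMost d (subposet P S)

    good? : ∀ P → Dec (Good P)
    good? P = anySubset? λ S → (∣ S ∣ ≟ⁿ m) ×-dec dimensionAtMost? P S d

    fromMatrix : ∀ M → IsPartialOrder _≡_ (rel M) → FinPoset n
    fromMatrix M po = record
      { _⊑_ = rel M
      ; isDecPartialOrder = record
        { isPartialOrder = po ; _≟_ = _≟ᶠ_ ; _≤?_ = λ x y → combine x y ∈? M }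
      }

    Bad : Subset (n * n) → Set₁
    Bad M = Σ (IsPartialOrder _≡_ (rel M)) λ po → ¬ Good (fromMatrix M po)

    bad? : Decidable Bad
    bad? M with Search.isPartialOrder? all? isEquivalence _≟ᶠ_ (λ x y → combine x y ∈? M)
    ... | no ¬po = no (¬po ∘ proj₁)
    ... | yes po = map′ (po ,_)
      (λ (po′ , ¬g) (S , s , dim) → ¬g (S , s ,
        DimensionAtMost-resp {P = fromMatrix M po} {fromMatrix M po′} S (λ _ _ → mk⇔ (λ r → r) (λ r → r)) dim))
      (¬? (good? (fromMatrix M po)))

    to : ¬ ∃ Bad → Guaranteed d n m
    to ¬bad P = decidable-stable (good? P) λ ¬g → ¬bad (M , po , λ (S , s , dim) →
      ¬g (S , s , DimensionAtMost-resp {P = fromMatrix M po} {P} S e dim))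
      where
      module D = IsDecPartialOrder (FinPoset.isDecPartialOrder P)
      matrix = rel-surjective D._≤?_
      M = proj₁ matrix
      e = proj₂ matrix
      module E x y = Equivalence (e x y)
      po : IsPartialOrder _≡_ (rel M)
      po = record
        { isPreorder = record
          { isEquivalence = isEquivalence
          ; reflexive     = λ {x} {y} → E.from x y ∘ D.reflexive
          ; trans         = λ {x} {y} {z} p q → E.from x z (D.trans (E.to x y p) (E.to y z q))
          }
        ; antisym = λ {x} {y} p q → D.antisym (E.to x y p) (E.to y x q)
        }

    from : Guaranteed d n m → ¬ ∃ Bad
    from g (M , po , ¬good) = ¬good (g (fromMatrix M po))

  guaranteed-0 : ∀ d n → Guaranteed d n 0
  guaranteed-0 d n P = ⊥ , ∣⊥∣≡0 n , 0 , (empty , λ _ _ → z≤n) , z≤n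
    where
    empty : HasRealizer (subposet P ⊥) 0
    empty = (λ ()) , (λ ()) , λ u _ → contradiction (proj₂ u) ∉⊥

  guaranteed-≤ : ∀ d n m → Guaranteed d n m → m ≤ n
  guaranteed-≤ d n m g = let (S , s , _) = g chain in subst (_≤ n) s (∣p∣≤n S)
    where
    chain : FinPoset n
    chain = record { isDecPartialOrder = IsDecTotalOrder.isDecPartialOrder ≤ᶠ-isDecTotalOrder }

  abstract
    f-exists : ∀ d n → ∃ (IsLargest (Guaranteed d n))
    f-exists d n = largest (guaranteed? d n) (guaranteed-0 d n) n (guaranteed-≤ d n)

f : ℕ → ℕ → ℕ
f d n = proj₁ (f-exists d n)

f-isLargest : ∀ d n → IsLargest (Guaranteed d n) (f d n)
f-isLargest d n = proj₂ (f-exists d n)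

-- g(n) = O(n^(p/q)) as n → ∞: the inequality g(n) ≤ C · n^(p/q) is
-- raised to the power q, and a real constant may be rounded up to C.
_=O[n^_/_] : (ℕ → ℕ) → (p q : ℕ) → .{{NonZero q}} → Set
g =O[n^ p / q ] = ∃ λ C → ∃ λ N → ∀ n → N ≤ n → g n ^ q ≤ C ^ q * n ^ p

{-# OPTIONS --safe #-}

-- For n ≤ t^(d+1) take n points of the grid [t]^(d+1) under the product
-- order.  A set P of grid points has a k-minor when the map u ↦ p(u) from
-- [k]^(d+1) to P can be chosen so that u_j < v_j implies p(u)_j < p(v)_j.
-- A 4-minor contains the standard example a_i ≤ b_l ⇔ i ≠ l on d+1 pairs,
-- which has dimension d+1, so it suffices that a set without k-minors has
-- O(t^d) points.  This is the Marcus–Tardos argument as extended to higher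
-- dimensions by Klazar and Marcus: cut the grid into blocks of side K = k².
-- A block meeting fewer than k residue layers in every direction holds at
-- most (k-1)^(d+1) points, and such blocks are counted by recursion on t.
-- The blocks of one slab orthogonal to a direction that meet the same k
-- layers form, after projection, a set without k-minors one dimension lower.
module Submission where

open import Data.Bool using (if_then_else_)
open import Data.Fin using (Fin; zero; suc; combine; quotient; remainder; inject≤; punchIn; punchOut; toℕ; #_)
import Data.Fin as F
import Data.Fin.Properties as F
open import Data.Fin.Subset using (Subset; ∣_∣; inside; outside) renaming (_∈_ to _∈ₛ_)
open import Data.List using (List; []; _∷_; length; map; filter; allFin; deduplicate)
import Data.List as List
open import Data.List.Membership.Propositional using (_∈_; find; lose)
open import Data.List.Membership.Propositional.Properties
  using (∈-map⁺; ∈-filter⁺; ∈-filter⁻; ∈-deduplicate⁺; ∈-allFin; ∈-lookup)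
open import Data.List.Properties using (length-map; length-tabulate)
open import Data.List.Relation.Binary.Sublist.Propositional using (_⊆_; []; _∷_; _∷ʳ_)
open import Data.List.Relation.Binary.Sublist.Propositional.Properties using (All-resp-⊆)
open import Data.List.Relation.Unary.All as All using (All; []; _∷_)
import Data.List.Relation.Unary.All.Properties as All
open import Data.List.Relation.Unary.AllPairs using (AllPairs; []; _∷_)
import Data.List.Relation.Unary.AllPairs.Properties as AllPairs
open import Data.List.Relation.Unary.Any as Any using (Any; any?)
open import Data.List.Relation.Unary.Unique.DecPropositional.Properties using (deduplicate-!)
open import Data.List.Relation.Unary.Unique.Propositional using (Unique)
import Data.List.Relation.Unary.Unique.Propositional.Properties as Unique
open import Data.Nat using (ℕ; zero; suc; _+_; _*_; _^_; _≤_; _<_; z≤n; s≤s; NonZero; >-nonZero; _≤?_)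
open import Data.Nat.Properties
open import Data.Nat.Tactic.RingSolver using (solve-∀)
open import Data.Product using (∃; Σ; ∃₂; _×_; _,_; proj₁; proj₂)
open import Data.Sum as Sum using (_⊎_; inj₁; inj₂)
open import Data.Vec as Vec using (Vec; []; _∷_; lookup; insertAt; removeAt; tabulate; here; there)
import Data.Vec.Properties as Vec
open import Function using (_∘_; id; case_of_; Equivalence)
open import Level using (0ℓ)
open import Relation.Binary using (DecidableEquality; Rel; Poset; IsTotalOrder)
open import Relation.Binary.PropositionalEquality
open import Relation.Nullary using (¬_; does; yes; no; contradiction)
open import Relation.Nullary.Decidable using (_×-dec_; dec-true)
open import Relation.Unary using (Pred; Decidable)
open import Defs

private
  variable
    X Y : Set
    P Q Q₁ Q₂ : Pred X 0ℓ
    c d h k m n t : ℕ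

-- Counting the members of a predicate.

-- Cardinality is bounded through duplicate-free lists so that `P` may be undecidable and have no
-- enumeration.
AtMost : Pred X 0ℓ → ℕ → Set
AtMost {X} P n = (xs : List X) → Unique xs → All P xs → length xs ≤ n

AtMost-≤ : m ≤ n → AtMost P m → AtMost P n
AtMost-≤ m≤n P≤m xs xs! Pxs = ≤-trans (P≤m xs xs! Pxs) m≤n

-- The empty set meets every bound, so a bound may be proved with a member in hand.
AtMost-inhabited : (∀ {x} → P x → AtMost P n) → AtMost P n
AtMost-inhabited P≤n []       _   _            = z≤n
AtMost-inhabited P≤n (x ∷ xs) xs! Pxs@(px ∷ _) = P≤n px (x ∷ xs) xs! Pxs

AtMost-injective : (g : X → Y) → (∀ {x} → P x → Q (g x)) →
                   (∀ {x y} → P x → P y → g x ≡ g y → x ≡ y) → AtMost Q n → AtMost P n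
AtMost-injective {P = P} g P⇒Q inj Q≤n xs xs! Pxs =
  subst (_≤ _) (length-map g xs)
    (Q≤n (map g xs) (AllPairs.map⁺ (distinct xs! Pxs)) (All.map⁺ (All.map P⇒Q Pxs)))
  where
  distinct : ∀ {xs} → Unique xs → All P xs → AllPairs (λ x y → g x ≢ g y) xs
  distinct []         []         = []
  distinct (x∉ ∷ xs!) (px ∷ Pxs) =
    All.zipWith (λ (x≢y , py) → x≢y ∘ inj px py) (x∉ , Pxs) ∷ distinct xs! Pxs

AtMost-⊆ : (∀ {x} → P x → Q x) → AtMost Q n → AtMost P n
AtMost-⊆ P⇒Q Q≤n xs xs! Pxs = Q≤n xs xs! (All.map P⇒Q Pxs)

AtMost-⊎ : (∀ {x} → P x → Q₁ x ⊎ Q₂ x) → AtMost Q₁ m → AtMost Q₂ n → AtMost P (m + n)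
AtMost-⊎ {P = P} {Q₁} {Q₂} cases Q₁≤m Q₂≤n xs xs! Pxs =
  let ys , zs , (_ , ys! , Q₁ys) , (_ , zs! , Q₂zs) , eq = split xs! Pxs in
  ≤-trans (≤-reflexive eq) (+-mono-≤ (Q₁≤m ys ys! Q₁ys) (Q₂≤n zs zs! Q₂zs))
  where
  split : ∀ {xs} → Unique xs → All P xs →
          ∃₂ λ ys zs → (ys ⊆ xs × Unique ys × All Q₁ ys) × (zs ⊆ xs × Unique zs × All Q₂ zs) ×
                       length xs ≡ length ys + length zs
  split [] [] = [] , [] , ([] , [] , []) , ([] , [] , []) , refl
  split {x ∷ _} (x∉ ∷ xs!) (px ∷ Pxs) with split xs! Pxs | cases px
  ... | ys , zs , (ys⊆ , ys! , Q₁ys) , (zs⊆ , zs! , Q₂zs) , eq | inj₁ q =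
    x ∷ ys , zs , (refl ∷ ys⊆ , All-resp-⊆ ys⊆ x∉ ∷ ys! , q ∷ Q₁ys) , (x ∷ʳ zs⊆ , zs! , Q₂zs) , cong suc eq
  ... | ys , zs , (ys⊆ , ys! , Q₁ys) , (zs⊆ , zs! , Q₂zs) , eq | inj₂ q =
    ys , x ∷ zs , (x ∷ʳ ys⊆ , ys! , Q₁ys) , (refl ∷ zs⊆ , All-resp-⊆ zs⊆ x∉ ∷ zs! , q ∷ Q₂zs) ,
    trans (cong suc eq) (sym (+-suc _ _))

AtMost-Any : {R : X → Y → Set} (ys : List Y) → (∀ {x} → P x → Any (R x) ys) →
             (∀ y → AtMost (λ x → R x y) c) → AtMost P (length ys * c)
AtMost-Any []       cover _   []      _ _        = z≤n
AtMost-Any []       cover _   (_ ∷ _) _ (px ∷ _) = contradiction (cover px) λ ()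
AtMost-Any {R = R} (y ∷ ys) cover R≤c =
  AtMost-⊎ (Any.toSum ∘ cover) (R≤c y) (AtMost-Any {R = R} ys id R≤c)

AtMost-Fin : {R : X → Fin n → Set} → (∀ {x} → P x → ∃ λ i → R x i) →
             (∀ i → AtMost (λ x → R x i) c) → AtMost P (n * c)
AtMost-Fin {n = n} {P = P} {c = c} {R = R} cover R≤c =
  subst (λ l → AtMost P (l * c)) (length-tabulate {n = n} id)
    (AtMost-Any {R = R} (allFin n) (λ px → let i , r = cover px in lose (∈-allFin i) r) R≤c)

AtMost-VecFin : {R : X → Vec (Fin n) k → Set} → (∀ {x} → P x → ∃ λ v → R x v) →
                (∀ v → AtMost (λ x → R x v) c) → AtMost P (n ^ k * c)
AtMost-VecFin {k = zero} {c = c} {R = R} cover R≤c =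
  AtMost-⊆ {Q = λ x → R x []} (λ px → case cover px of λ { ([] , r) → r })
    (AtMost-≤ (≤-reflexive (sym (*-identityˡ c))) (R≤c []))
AtMost-VecFin {n = n} {k = suc k} {P = P} {c = c} {R = R} cover R≤c =
  subst (AtMost P) (sym (*-assoc n (n ^ k) c))
    (AtMost-Fin {R = λ x i → ∃ λ v → R x (i ∷ v)} (λ px → case cover px of λ { (i ∷ v , r) → i , v , r })
      λ i → AtMost-VecFin id (R≤c ∘ (i ∷_)))

AtMost-fibres : DecidableEquality Y → (g : X → Y) → (∀ {x} → P x → Q (g x)) → AtMost Q n →
                (∀ y → AtMost (λ x → P x × g x ≡ y) c) → AtMost P (n * c)
AtMost-fibres {P = P} {Q = Q} {c = c} _≟_ g P⇒Q Q≤n fibres xs xs! Pxs =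
  ≤-trans
    -- Only the values of `g` on `xs` matter: once `P` is cut down to `xs`, the finitely many values
    -- in `ys` index a cover, even if `Q` cannot be enumerated.
    (AtMost-Any {P = λ x → P x × x ∈ xs} ys
      (λ (px , x∈) → Any.map (px ,_) (∈-deduplicate⁺ _≟_ (∈-map⁺ g x∈))) fibres
      xs xs! (All.zip (Pxs , All.tabulate id)))
    (*-monoˡ-≤ c (Q≤n ys (deduplicate-! _≟_ _) (All.deduplicate⁺ _≟_ (All.map⁺ (All.map P⇒Q Pxs)))))
  where
  ys = deduplicate _≟_ (map g xs)

AtMost-singleton : (∀ {x y} → P x → P y → x ≡ y) → AtMost P 1
AtMost-singleton eq []           _                  _                = z≤n
AtMost-singleton eq (_ ∷ [])     _                  _                = s≤s z≤n
AtMost-singleton eq (_ ∷ _ ∷ _) ((x≢y ∷ _) ∷ _) (px ∷ py ∷ _) = contradiction (eq px py) x≢y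

AtMost-Vec : {Q : Fin k → Pred X 0ℓ} → DecidableEquality X → (∀ i → AtMost (Q i) n) →
             AtMost (λ (v : Vec X k) → ∀ i → Q i (lookup v i)) (n ^ k)
AtMost-Vec {zero}  _≟_ Q≤n = AtMost-singleton λ { {[]} {[]} _ _ → refl }
AtMost-Vec {suc k} _≟_ Q≤n =
  AtMost-fibres _≟_ Vec.head (λ { {_ ∷ _} q → q zero }) (Q≤n zero) λ _ →
    AtMost-injective Vec.tail (λ { {_ ∷ _} (q , _) → q ∘ suc })
      (λ { {_ ∷ _} {_ ∷ _} (_ , refl) (_ , refl) refl → refl }) (AtMost-Vec _≟_ (Q≤n ∘ suc))

AtMost-universe : {P : Pred (Fin n) 0ℓ} → AtMost P n
AtMost-universe {n} {P} =
  subst (AtMost P) (*-identityʳ n)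
    (AtMost-Fin {R = _≡_} (λ _ → _ , refl) λ _ → AtMost-singleton λ p q → trans p (sym q))

-- Increasing selections and minors.

Increasing : Vec (Fin n) k → Set
Increasing v = ∀ i j → i F.< j → lookup v i F.< lookup v j

-- Filtering `allFin n` lists the members of `Q` in increasing order; either the first `suc h` of
-- them can be taken or there are at most `h`. This dichotomy separates wide blocks from thin ones.
increasing⊎atMost : ∀ h {Q : Pred (Fin n) 0ℓ} → Decidable Q →
                    (∃ λ (v : Vec (Fin n) (suc h)) → Increasing v × ∀ i → Q (lookup v i)) ⊎ AtMost Q h
increasing⊎atMost {n} h {Q} Q? with suc h ≤? length (filter Q? (allFin n))
... | yes h< = inj₁ (tabulate pick , increasing , λ i →
    subst Q (sym (Vec.lookup∘tabulate pick i)) (proj₂ (∈-filter⁻ Q? {xs = allFin n} (∈-lookup (inject≤ i h<)))))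
  where
  qs : List (Fin n)
  qs = filter Q? (allFin n)

  pick : Fin (suc h) → Fin n
  pick i = List.lookup qs (inject≤ i h<)

  lookup-mono : ∀ {xs : List (Fin n)} → AllPairs F._<_ xs →
                ∀ i j → i F.< j → List.lookup xs i F.< List.lookup xs j
  lookup-mono (x< ∷ _)  zero    (suc j) _         = All.lookup x< (∈-lookup j)
  lookup-mono (_ ∷ xs<) (suc i) (suc j) (s≤s i<j) = lookup-mono xs< i j i<j

  increasing : Increasing (tabulate pick)
  increasing i j i<j
    rewrite Vec.lookup∘tabulate pick i | Vec.lookup∘tabulate pick j =
    lookup-mono (AllPairs.filter⁺ Q? (AllPairs.tabulate⁺-< id)) _ _
      (subst₂ _<_ (sym (F.toℕ-inject≤ i h<)) (sym (F.toℕ-inject≤ j h<)) i<j)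
... | no h≮ = inj₂ (AtMost-≤ (≤-trans (≤-reflexive (*-identityʳ _)) (≤-pred (≰⇒> h≮)))
                     (AtMost-Any {R = _≡_} (filter Q? (allFin n)) (∈-filter⁺ Q? (∈-allFin _))
                       λ _ → AtMost-singleton λ p q → trans p (sym q)))

∃⊎∀ : {P Q : Pred (Fin n) 0ℓ} → (∀ i → P i ⊎ Q i) → ∃ P ⊎ (∀ i → Q i)
∃⊎∀ {zero}  _   = inj₂ λ ()
∃⊎∀ {suc n} p⊎q with p⊎q zero | ∃⊎∀ (p⊎q ∘ suc)
... | inj₁ p | _            = inj₁ (zero , p)
... | inj₂ _ | inj₁ (i , p) = inj₁ (suc i , p)
... | inj₂ q | inj₂ qs      = inj₂ λ { zero → q ; (suc i) → qs i }

-- For k ≥ 1 this is the all-ones array as an interval minor: each direction splits into k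
-- consecutive intervals so that all k^d resulting boxes meet `P`.
HasMinor : ℕ → Pred (Vec (Fin t) d) 0ℓ → Set
HasMinor {t} {d} k P =
  Σ (Vec (Fin k) d → Vec (Fin t) d) λ p →
    (∀ u → P (p u)) ×
    (∀ u v j → lookup u j F.< lookup v j → lookup (p u) j F.< lookup (p v) j)

-- The dimension is e+1 and the forbidden minor has side h+1, so that `h` is the number of layers a
-- thin block may meet.
Sparse : (h t e C : ℕ) → Set₁
Sparse h t e C = (P : Pred (Vec (Fin t) (suc e)) 0ℓ) → ¬ HasMinor (suc h) P → AtMost P (C * t ^ e)

sparse-line : ∀ h t → Sparse h t 0 h
-- On a line, h+1 points in increasing order already form the minor. They are sought in `xs`, where
-- membership is decidable.
sparse-line h t P free xs xs! Pxs with increasing⊎atMost h (λ i → any? (Vec.≡-dec F._≟_ (i ∷ [])) xs)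
... | inj₁ (v , v-inc , v∈) = contradiction minor free
  where
  minor : HasMinor (suc h) P
  minor = (λ u → lookup v (lookup u zero) ∷ [])
        , (λ u → All.lookup Pxs (v∈ (lookup u zero)))
        , λ { u w zero u<w → v-inc _ _ u<w }
... | inj₂ h≥ =
  AtMost-≤ (≤-reflexive (sym (*-identityʳ h)))
    (AtMost-injective {P = _∈ xs} Vec.head (λ { {_ ∷ []} x∈ → x∈ }) (λ { {_ ∷ []} {_ ∷ []} _ _ refl → refl }) h≥)
    xs xs! (All.tabulate id)

-- Blocks of side K.

quotient-cancel-< : ∀ K {x y : Fin (t * K)} → quotient {t} K x F.< quotient {t} K y → x F.< y
quotient-cancel-< {t} K {x} {y} =
  subst₂ F._<_ (F.combine-remQuot {t} K x) (F.combine-remQuot {t} K y) ∘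
  F.combine-monoˡ-< (remainder {t} K x) (remainder {t} K y)

remainder-cancel-< : ∀ K {x y : Fin (t * K)} → quotient {t} K x ≡ quotient {t} K y →
                     remainder {t} K x F.< remainder {t} K y → x F.< y
remainder-cancel-< {t} K {x} {y} eq r< =
  subst₂ F._<_ (F.combine-remQuot {t} K x) (F.combine-remQuot {t} K y)
    (subst (λ q → combine (quotient {t} K x) (remainder {t} K x) F.< combine q (remainder {t} K y)) eq
      (subst₂ _<_ (sym (F.toℕ-combine (quotient {t} K x) _)) (sym (F.toℕ-combine (quotient {t} K x) _))
        (+-monoʳ-< (K * toℕ (quotient {t} K x)) r<)))

-- The point set is a list, which makes `Occupied` decidable. Each coordinate splits into a block
-- index in `Fin t` and a residue in `Fin K`.
module Blocks {t K d : ℕ} (A : List (Vec (Fin (t * K)) d)) where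

  block : Vec (Fin (t * K)) d → Vec (Fin t) d
  block = Vec.map (quotient K)

  residues : Vec (Fin (t * K)) d → Vec (Fin K) d
  residues = Vec.map (remainder {t} K)

  Occupied : Vec (Fin t) d → Fin d → Pred (Fin K) 0ℓ
  Occupied b j r = Any (λ x → block x ≡ b × lookup (residues x) j ≡ r) A

  occupied? : ∀ b j → Decidable (Occupied b j)
  occupied? b j r = any? (λ x → Vec.≡-dec F._≟_ (block x) b ×-dec (lookup (residues x) j F.≟ r)) A

  Contraction : Pred (Vec (Fin t) d) 0ℓ
  Contraction b = Any (λ x → block x ≡ b) A

  WideAlong : Fin d → Vec (Fin K) k → Pred (Vec (Fin t) d) 0ℓ
  WideAlong j v b = Increasing v × ∀ i → Occupied b j (lookup v i)

  Thin : ℕ → Pred (Vec (Fin t) d) 0ℓ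
  Thin h b = ∀ j → AtMost (Occupied b j) h

  block-residues-injective : ∀ {x y} → block x ≡ block y → residues x ≡ residues y → x ≡ y
  block-residues-injective = go
    where
    go : ∀ {d} {x y : Vec (Fin (t * K)) d} → Vec.map (quotient K) x ≡ Vec.map (quotient K) y →
         Vec.map (remainder {t} K) x ≡ Vec.map (remainder {t} K) y → x ≡ y
    go {x = []} {[]} _ _ = refl
    go {x = x ∷ xs} {y ∷ ys} q r = cong₂ _∷_
      (trans (sym (F.combine-remQuot {t} K x))
        (trans (cong₂ combine (Vec.∷-injectiveˡ q) (Vec.∷-injectiveˡ r)) (F.combine-remQuot {t} K y)))
      (go (Vec.∷-injectiveʳ q) (Vec.∷-injectiveʳ r))

  block-cancel-< : ∀ x y j → lookup (block x) j F.< lookup (block y) j → lookup x j F.< lookup y j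
  block-cancel-< x y j =
    quotient-cancel-< K ∘ subst₂ F._<_ (Vec.lookup-map j (quotient K) x) (Vec.lookup-map j (quotient K) y)

  residues-cancel-< : ∀ x y j → lookup (block x) j ≡ lookup (block y) j →
                      lookup (residues x) j F.< lookup (residues y) j → lookup x j F.< lookup y j
  residues-cancel-< x y j q r = remainder-cancel-< K
    (subst₂ _≡_ (Vec.lookup-map j (quotient K) x) (Vec.lookup-map j (quotient K) y) q)
    (subst₂ F._<_ (Vec.lookup-map j (remainder {t} K) x) (Vec.lookup-map j (remainder {t} K) y) r)

  -- Any choice of one point per block works, since a strict inequality of block indices passes to
  -- the points.
  contraction-minor : HasMinor k Contraction → HasMinor k (_∈ A)
  contraction-minor (p , p∈ , p-mono) =
    x , (λ u → proj₁ (proj₂ (find (p∈ u)))) , λ u v j u<v →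
      block-cancel-< (x u) (x v) j
        (subst₂ (λ b b′ → lookup b j F.< lookup b′ j) (sym (block-x u)) (sym (block-x v)) (p-mono u v j u<v))
    where
    x : Vec (Fin _) d → Vec (Fin (t * K)) d
    x u = proj₁ (find (p∈ u))

    block-x : ∀ u → block (x u) ≡ p u
    block-x u = proj₂ (proj₂ (find (p∈ u)))

  -- Within one block the residues determine a point, and they lie in a product of d sets with at
  -- most `h` members each.
  block-size : ∀ b → Thin h b → AtMost (λ x → x ∈ A × block x ≡ b) (h ^ d)
  block-size b thin = AtMost-injective residues
    (λ (x∈ , p) i → lose x∈ (p , refl))
    (λ (_ , p) (_ , q) → block-residues-injective (trans p (sym q)))
    (AtMost-Vec F._≟_ thin)

module Step {h t K e : ℕ} (A : List (Vec (Fin (t * K)) (suc (suc e))))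
            (free : ¬ HasMinor (suc h) (_∈ A)) where
  open Blocks {t} {K} A

  -- All these blocks lie in slab `a` and share the layers `v`. For each `u`, the projected minor
  -- chooses the block from the coordinates of `u` other than `j`, and coordinate `j` chooses the
  -- layer of `v` in it. Residues then settle comparisons along `j`, block indices all others.
  slab-minor : ∀ {j v a} → HasMinor (suc h) (λ y → WideAlong j v (insertAt y j a)) → HasMinor (suc h) (_∈ A)
  slab-minor {j} {v} {a} (p , wide , p-mono) = proj₁ ∘ x , proj₁ ∘ proj₂ ∘ x , mono
    where
    x : ∀ u → ∃ λ x → x ∈ A × block x ≡ insertAt (p (removeAt u j)) j a ×
                      lookup (residues x) j ≡ lookup v (lookup u j)
    x u = find (proj₂ (wide (removeAt u j)) (lookup u j))

    block-x : ∀ u → block (proj₁ (x u)) ≡ insertAt (p (removeAt u j)) j a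
    block-x u = proj₁ (proj₂ (proj₂ (x u)))

    residue-x : ∀ u → lookup (residues (proj₁ (x u))) j ≡ lookup v (lookup u j)
    residue-x u = proj₂ (proj₂ (proj₂ (x u)))

    block-along : ∀ u → lookup (block (proj₁ (x u))) j ≡ a
    block-along u = trans (cong (λ b → lookup b j) (block-x u)) (Vec.insertAt-lookup (p (removeAt u j)) j a)

    block-across : ∀ u {i} (j≢i : j ≢ i) →
                   lookup (block (proj₁ (x u))) i ≡ lookup (p (removeAt u j)) (punchOut j≢i)
    block-across u {i} j≢i = begin
      lookup (block (proj₁ (x u))) i
        ≡⟨ cong₂ lookup (block-x u) (sym (F.punchIn-punchOut j≢i)) ⟩
      lookup (insertAt (p (removeAt u j)) j a) (punchIn j (punchOut j≢i))
        ≡⟨ Vec.insertAt-punchIn (p (removeAt u j)) j a (punchOut j≢i) ⟩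
      lookup (p (removeAt u j)) (punchOut j≢i) ∎
      where open ≡-Reasoning

    mono : ∀ u w i → lookup u i F.< lookup w i → lookup (proj₁ (x u)) i F.< lookup (proj₁ (x w)) i
    mono u w i u<w with j F.≟ i
    ... | yes refl = residues-cancel-< (proj₁ (x u)) (proj₁ (x w)) j (trans (block-along u) (sym (block-along w)))
      (subst₂ F._<_ (sym (residue-x u)) (sym (residue-x w)) (proj₁ (wide (removeAt u j)) _ _ u<w))
    ... | no j≢i = block-cancel-< (proj₁ (x u)) (proj₁ (x w)) i
      (subst₂ F._<_ (sym (block-across u j≢i)) (sym (block-across w j≢i))
        (p-mono _ _ (punchOut j≢i)
          (subst₂ F._<_ (sym (Vec.removeAt-punchOut u j≢i)) (sym (Vec.removeAt-punchOut w j≢i)) u<w)))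

  WideSomewhere : Pred (Vec (Fin t) (suc (suc e))) 0ℓ
  WideSomewhere b = ∃ λ j → ∃ λ (v : Vec (Fin K) (suc h)) → WideAlong j v b

  wide⊎thin : ∀ b → WideSomewhere b ⊎ Thin h b
  wide⊎thin b = ∃⊎∀ λ j → increasing⊎atMost h (occupied? b j)

  -- The factors count the directions `j`, the candidate layer vectors `v`, the slabs `a`, and the
  -- projected blocks for each such choice, which have no minor by `slab-minor`.
  wide-blocks : ∀ {C} → Sparse h t e C → AtMost WideSomewhere (suc (suc e) * (K ^ suc h * (t * (C * t ^ e))))
  wide-blocks {C} sparse =
    AtMost-Fin id λ j →
    AtMost-VecFin {R = λ b v → WideAlong j v b} id λ v →
    AtMost-Fin {R = λ b a → WideAlong j v b × lookup b j ≡ a} (λ wide → _ , wide , refl) λ a →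
    AtMost-injective {Q = λ y → WideAlong j v (insertAt y j a)} (λ b → removeAt b j)
      (λ { {b} (wide , refl) → subst (WideAlong j v) (sym (Vec.insertAt-removeAt b j)) wide })
      (λ { {b} {b′} (_ , refl) (_ , eq) eq′ → trans (sym (Vec.insertAt-removeAt b j))
             (trans (cong₂ (λ y a → insertAt y j a) eq′ (sym eq)) (Vec.insertAt-removeAt b′ j)) })
      (sparse _ (free ∘ slab-minor {v = v}))

  points : ∀ {C C′} → Sparse h t e C → Sparse h t (suc e) C′ →
           AtMost (_∈ A) ( suc (suc e) * (K ^ suc h * (t * (C * t ^ e))) * K ^ suc (suc e)
                         + C′ * t ^ suc e * h ^ suc (suc e))
  points {C} sparse sparse′ =
    AtMost-⊎ {Q₁ = λ x → x ∈ A × WideSomewhere (block x)} {Q₂ = λ x → x ∈ A × Thin h (block x)}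
      (λ {x} x∈ → Sum.map (x∈ ,_) (x∈ ,_) (wide⊎thin (block x)))
      -- Wide blocks are few enough to be counted as full, with all K^(e+2) points.
      (AtMost-fibres (Vec.≡-dec F._≟_) block proj₂ (wide-blocks {C} sparse) λ b →
        AtMost-⊆ (λ ((x∈ , _) , eq) → x∈ , eq) (block-size b λ _ → AtMost-universe))
      (AtMost-fibres (Vec.≡-dec F._≟_) block
        (λ { {x} (x∈ , _) → lose {P = λ y → block y ≡ block x} x∈ refl })
        (sparse′ Contraction (free ∘ contraction-minor)) λ b →
        -- `Contraction` does not record thinness; a point of the fibre supplies it.
        AtMost-inhabited λ ((_ , thin) , eq) →
        AtMost-⊆ (λ ((x∈ , _) , eq) → x∈ , eq) (block-size b (subst (Thin h) eq thin)))

-- Recursion on the side of the grid.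

^-distribʳ-* : ∀ e m n → (m * n) ^ e ≡ m ^ e * n ^ e
^-distribʳ-* zero    m n = refl
^-distribʳ-* (suc e) m n = trans (cong (m * n *_) (^-distribʳ-* e m n)) (interchange m n (m ^ e) (n ^ e))
  where
  interchange : ∀ m n p q → m * n * (p * q) ≡ m * p * (n * q)
  interchange = solve-∀

-- With T = t^(e+1), wide blocks contribute at most C′T and thin ones at most C′T h^(e+2). The sum
-- fits under C′T K^(e+1) because h^(e+2) < K^(e+1).
sparse-step : ∀ {h t K e C C′} → h ^ suc (suc e) < K ^ suc e →
              suc (suc e) * (K ^ suc h * C) * K ^ suc (suc e) ≤ C′ →
              Sparse h t e C → Sparse h t (suc e) C′ → Sparse h (t * K) (suc e) C′
sparse-step {h} {t} {K} {e} {C} {C′} H<K W≤C′ sparse sparse′ P free xs xs! Pxs =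
  AtMost-≤ bound (Step.points xs free-xs {C} {C′} sparse sparse′) xs xs! (All.tabulate id)
  where
  open ≤-Reasoning

  free-xs : ¬ HasMinor (suc h) (_∈ xs)
  free-xs (p , p∈ , mono) = free (p , (λ u → All.lookup Pxs (p∈ u)) , mono)

  D = suc (suc e)
  V = K ^ suc h
  B = K ^ suc (suc e)
  H = h ^ suc (suc e)
  T = t ^ suc e

  bound : D * (V * (t * (C * t ^ e))) * B + C′ * T * H ≤ C′ * (t * K) ^ suc e
  bound = begin
    D * (V * (t * (C * t ^ e))) * B + C′ * T * H ≡⟨ cong (_+ C′ * T * H) (rearrange D V t C (t ^ e) B) ⟩
    D * (V * C) * B * T + C′ * T * H             ≤⟨ +-monoˡ-≤ (C′ * T * H) (*-monoˡ-≤ T W≤C′) ⟩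
    C′ * T + C′ * T * H                          ≡⟨ *-suc (C′ * T) H ⟨
    C′ * T * suc H                               ≤⟨ *-monoʳ-≤ (C′ * T) H<K ⟩
    C′ * T * K ^ suc e                           ≡⟨ *-assoc C′ T (K ^ suc e) ⟩
    C′ * (T * K ^ suc e)                         ≡⟨ cong (C′ *_) (^-distribʳ-* (suc e) t K) ⟨
    C′ * (t * K) ^ suc e                         ∎
    where
    rearrange : ∀ D V t C U B → D * (V * (t * (C * U))) * B ≡ D * (V * C) * B * (t * U)
    rearrange = solve-∀

sparse-unit : ∀ {h e C} → 1 ≤ C → Sparse h 1 e C
sparse-unit {h} {e} {C} 1≤C P _ =
  AtMost-≤ (≤-trans 1≤C (≤-reflexive (sym (trans (cong (C *_) (^-zeroˡ e)) (*-identityʳ C)))))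
    (AtMost-singleton λ _ _ → all-equal)
  where
  all-equal : ∀ {n} {x y : Vec (Fin 1) n} → x ≡ y
  all-equal {x = []}        {[]}        = refl
  all-equal {x = zero ∷ xs} {zero ∷ ys} = cong (zero ∷_) all-equal

-- The outer induction is on the dimension, the inner one on `r`; the constant is fixed before `r`.
sparse-powers : ∀ h e → ∃ λ C → ∀ r → Sparse h ((suc h * suc h) ^ r) e C
sparse-powers h zero    = h , λ r → sparse-line h _
sparse-powers h (suc e) with sparse-powers h e
... | C , sparse = C′ , go
  where
  -- The square gives K^(e+1) = (h+1)^(2e+2), and 2e+2 ≥ e+2.
  K = suc h * suc h
  -- The outer `suc` makes C′ positive, as the one-point grid at r = 0 requires.
  C′ = suc (suc (suc e) * (K ^ suc h * C) * K ^ suc (suc e))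

  h<K : h ^ suc (suc e) < K ^ suc e
  h<K = begin-strict
    h ^ suc (suc e)               <⟨ ^-monoˡ-< (suc (suc e)) (n<1+n h) ⟩
    suc h * suc h ^ suc e         ≤⟨ *-monoˡ-≤ (suc h ^ suc e) (m≤m*n (suc h) (suc h ^ e) {{m^n≢0 (suc h) e}}) ⟩
    suc h ^ suc e * suc h ^ suc e ≡⟨ ^-distribʳ-* (suc e) (suc h) (suc h) ⟨
    K ^ suc e                     ∎
    where open ≤-Reasoning

  go : ∀ r → Sparse h (K ^ r) (suc e) C′
  go zero    = sparse-unit {h} {suc e} {C′} (s≤s z≤n)
  go (suc r) = subst (λ t → Sparse h t (suc e) C′) (*-comm (K ^ r) K)
    (sparse-step {C = C} h<K (n≤1+n _) (sparse r) (go r))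

-- Standard examples and dimension.

-- If a linear extension put b_i below a_i and b_j below a_j for some i ≠ j,
-- then b_i ≤ a_i ≤ b_j ≤ a_j ≤ b_i would be a cycle in it.
realizer-size : (P : Poset 0ℓ 0ℓ 0ℓ) → let open Poset P using (Carrier) renaming (_≤_ to _≼_) in
                (a b : Fin m → Carrier) → (∀ {i j} → i ≢ j → a i ≼ b j) → (∀ i → ¬ a i ≼ b i) →
                HasRealizer P k → m ≤ k
realizer-size P a b a≼b a⋠b (L , lins , realizes) = ≮⇒≥ λ k<m →
  let i , j , i<j , eq = F.pigeonhole k<m (proj₁ ∘ reversed)
      l = proj₁ (reversed i)
      open IsTotalOrder (IsLinearExtension.isTotalOrder (lins l)) renaming (trans to infixr 5 _∙_)
      extends = IsLinearExtension.extends (lins l)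
      bⱼ≤aⱼ = subst (λ l → L l (b j) (a j)) (sym eq) (proj₂ (reversed j))
      i≢j = F.<⇒≢ i<j
      aᵢ≤bᵢ = extends (a≼b i≢j) ∙ bⱼ≤aⱼ ∙ extends (a≼b (i≢j ∘ sym))
  in a⋠b i (Poset.reflexive P (antisym aᵢ≤bᵢ (proj₂ (reversed i))))
  where
  reversed : ∀ i → ∃ λ l → L l (b i) (a i)
  -- By totality, an extension that fails to put `b i` below `a i` puts `a i` below `b i`; if all
  -- did so, the realizer would give `a i ≼ b i`.
  reversed i with ∃⊎∀ (λ l → IsTotalOrder.total (IsLinearExtension.isTotalOrder (lins l)) (b i) (a i))
  ... | inj₁ found = found
  ... | inj₂ all≤  = contradiction (Equivalence.from (realizes (a i) (b i)) all≤) (a⋠b i)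

-- The points a_i = lower i and b_i = upper i of the standard example: on
-- coordinate j the order is a_i < b_j < a_j < b_l for all i, l ≠ j.
lower upper : Fin d → Vec (Fin 4) d
lower i = tabulate λ j → if does (i F.≟ j) then # 2 else # 0
upper i = tabulate λ j → if does (i F.≟ j) then # 1 else # 3

lookup-lower : ∀ (i j : Fin d) → lookup (lower i) j ≡ (if does (i F.≟ j) then # 2 else # 0)
lookup-lower i = Vec.lookup∘tabulate _

lookup-upper : ∀ (i j : Fin d) → lookup (upper i) j ≡ (if does (i F.≟ j) then # 1 else # 3)
lookup-upper i = Vec.lookup∘tabulate _

lower<upper : {i l : Fin d} → i ≢ l → ∀ j → lookup (lower i) j F.< lookup (upper l) j
lower<upper {i = i} {l} i≢l j rewrite lookup-lower i j | lookup-upper l j with i F.≟ j | l F.≟ j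
... | yes i≡j | yes l≡j = contradiction (trans i≡j (sym l≡j)) i≢l
... | yes _   | no  _   = s≤s (s≤s (s≤s z≤n))
... | no  _   | yes _   = s≤s z≤n
... | no  _   | no  _   = s≤s z≤n

upper<lower : (i : Fin d) → lookup (upper i) i F.< lookup (lower i) i
upper<lower i rewrite lookup-lower i i | lookup-upper i i | dec-true (i F.≟ i) refl = s≤s (s≤s z≤n)

-- Posets of grid points.

size≤ : (S : Subset n) → AtMost (_∈ₛ S) m → ∣ S ∣ ≤ m
size≤ S S≤m = let xs , eq , xs! , xs∈ = elements S in subst (_≤ _) eq (S≤m xs xs! xs∈)
  where
  elements : (S : Subset n) → ∃ λ xs → length xs ≡ ∣ S ∣ × Unique xs × All (_∈ₛ S) xs
  elements []            = [] , refl , [] , []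
  elements (b ∷ S) with elements S
  elements (outside ∷ S) | xs , eq , xs! , xs∈ =
    map suc xs , trans (length-map suc xs) eq , Unique.map⁺ F.suc-injective xs! , All.map⁺ (All.map there xs∈)
  elements (inside ∷ S)  | xs , eq , xs! , xs∈ =
    zero ∷ map suc xs , cong suc (trans (length-map suc xs) eq) ,
    All.map⁺ (All.tabulate λ _ ()) ∷ Unique.map⁺ F.suc-injective xs! ,
    here ∷ All.map⁺ (All.map there xs∈)

digits : ∀ d → Fin (t ^ d) → Vec (Fin t) d
digits         zero    _ = []
digits {t = t} (suc d) x = quotient (t ^ d) x ∷ digits d (remainder {t} (t ^ d) x)

digits-injective : ∀ d {x y : Fin (t ^ d)} → digits d x ≡ digits d y → x ≡ y
digits-injective         zero    {zero} {zero} _ = refl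
digits-injective {t = t} (suc d) {x}    {y}    eq = begin
  x ≡⟨ F.combine-remQuot {t} (t ^ d) x ⟨
  combine (quotient {t} (t ^ d) x) (remainder {t} (t ^ d) x)
    ≡⟨ cong₂ combine (Vec.∷-injectiveˡ eq) (digits-injective d (Vec.∷-injectiveʳ eq)) ⟩
  combine (quotient {t} (t ^ d) y) (remainder {t} (t ^ d) y)
    ≡⟨ F.combine-remQuot {t} (t ^ d) y ⟩
  y ∎
  where open ≡-Reasoning

module Grid {n d t : ℕ} (point : Fin n → Vec (Fin t) d)
            (point-injective : ∀ {x y} → point x ≡ point y → x ≡ y) where

  _⊑_ : Rel (Fin n) 0ℓ
  x ⊑ y = ∀ j → lookup (point x) j F.≤ lookup (point y) j

  grid : FinPoset n
  grid = record
    { _⊑_ = _⊑_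
    ; isDecPartialOrder = record
      { isPartialOrder = record
        { isPreorder = record
          { isEquivalence = isEquivalence
          ; reflexive     = λ { refl j → F.≤-refl }
          ; trans         = λ x⊑y y⊑z j → F.≤-trans (x⊑y j) (y⊑z j)
          }
        ; antisym = λ {x} {y} x⊑y y⊑x → point-injective (begin
            point x                      ≡⟨ Vec.tabulate∘lookup (point x) ⟨
            tabulate (lookup (point x))  ≡⟨ Vec.tabulate-cong (λ j → F.≤-antisym (x⊑y j) (y⊑x j)) ⟩
            tabulate (lookup (point y))  ≡⟨ Vec.tabulate∘lookup (point y) ⟩
            point y                      ∎)
        }
      ; _≟_  = F._≟_
      ; _≤?_ = λ x y → F.all? λ j → lookup (point x) j F.≤? lookup (point y) j
      }
    }
    where open ≡-Reasoning

  Image : Subset n → Pred (Vec (Fin t) d) 0ℓ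
  Image S v = ∃ λ x → x ∈ₛ S × point x ≡ v

  -- A minor preserves only strict inequalities of coordinates. `lower<upper` gives them in every
  -- coordinate when i ≠ l, and `upper<lower` reverses coordinate i for the pair i, so the images
  -- form a standard example on d pairs.
  minor-realizer : ∀ {S} → HasMinor 4 (Image S) → HasRealizer (subposet grid S) k → d ≤ k
  minor-realizer {S = S} (p , p∈ , p-mono) =
    realizer-size (subposet grid S) (element ∘ lower) (element ∘ upper)
      (λ {i} {l} i≢l j → <⇒≤ (mono (lower i) (upper l) j (lower<upper i≢l j)))
      (λ i a≤b → ≤⇒≯ (a≤b i) (mono (upper i) (lower i) i (upper<lower i)))
    where
    element : Vec (Fin 4) d → ∃ (_∈ₛ S)
    element u = proj₁ (p∈ u) , proj₁ (proj₂ (p∈ u))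

    mono : ∀ u v j → lookup u j F.< lookup v j →
           lookup (point (proj₁ (element u))) j F.< lookup (point (proj₁ (element v))) j
    mono u v j u<v =
      subst₂ (λ x y → lookup x j F.< lookup y j)
        (sym (proj₂ (proj₂ (p∈ u)))) (sym (proj₂ (proj₂ (p∈ v)))) (p-mono u v j u<v)

  -- A 4-minor in the image of `S` would force at least e+1 extensions in a realizer, against
  -- dimension at most e.
  guaranteed≤ : ∀ {e C} → d ≡ suc e → Sparse 3 t e C → Guaranteed e n m → m ≤ C * t ^ e
  guaranteed≤ refl sparse guaranteed with guaranteed grid
  ... | S , refl , k , (realizer , _) , k≤e =
    size≤ S (AtMost-injective {Q = Image S} point (λ x∈ → _ , x∈ , refl) (λ _ _ → point-injective)
      (sparse (Image S) λ minor → ≤⇒≯ k≤e (minor-realizer minor realizer)))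

f-bound : ∀ {C} → Sparse 3 t d C → n ≤ t ^ suc d → f d n ≤ C * t ^ d
f-bound {d = d} {n = n} {C = C} sparse n≤ =
  Grid.guaranteed≤ (λ x → digits (suc d) (inject≤ x n≤))
    (λ eq → F.inject≤-injective n≤ n≤ _ _ (digits-injective (suc d) eq))
    {C = C} refl sparse (proj₁ (f-isLargest d n))

-- Rounding n up to a full grid.

-- Induction on n: the exponent is raised only when b^r equals the previous value of n, so the
-- overshoot stays within a factor b.
power-above : ∀ {b} → 1 < b → ∀ n → 1 ≤ n → ∃ λ r → n ≤ b ^ r × b ^ r ≤ b * n
power-above {b} 1<b (suc zero)      _ = 0 , ≤-refl , ≤-trans (<⇒≤ 1<b) (≤-reflexive (sym (*-identityʳ b)))
power-above {b} 1<b (suc n@(suc _)) _ with power-above 1<b n (s≤s z≤n)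
... | r , n≤bʳ , bʳ≤bn with suc n ≤? b ^ r
...   | yes n<bʳ = r , n<bʳ , ≤-trans bʳ≤bn (*-monoʳ-≤ b (n≤1+n n))
...   | no  n≮bʳ = suc r , n<b¹⁺ʳ , *-monoʳ-≤ b (≤-trans (≤-pred (≰⇒> n≮bʳ)) (n≤1+n n))
  where
  open ≤-Reasoning
  n<b¹⁺ʳ : n < b * b ^ r
  n<b¹⁺ʳ = begin-strict
    n         ≤⟨ n≤bʳ ⟩
    b ^ r     <⟨ m<m*n (b ^ r) b {{>-nonZero (≤-trans (s≤s z≤n) n≤bʳ)}} 1<b ⟩
    b ^ r * b ≡⟨ *-comm (b ^ r) b ⟩
    b * b ^ r ∎

^-swap : ∀ m a b → (m ^ a) ^ b ≡ (m ^ b) ^ a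
^-swap m a b = begin
  (m ^ a) ^ b ≡⟨ ^-*-assoc m a b ⟩
  m ^ (a * b) ≡⟨ cong (m ^_) (*-comm a b) ⟩
  m ^ (b * a) ≡⟨ ^-*-assoc m b a ⟨
  (m ^ b) ^ a ∎
  where open ≡-Reasoning

-- Raising to the power d+1 and swapping exponents turns t^d into (t^(d+1))^d, where the bound in
-- terms of n can be substituted.
bound-rescale : ∀ {s C K n t} d → s ≤ C * t ^ d → t ^ suc d ≤ K ^ suc d * n →
        s ^ suc d ≤ (C * K ^ d) ^ suc d * n ^ d
bound-rescale {s} {C} {K} {n} {t} d s≤ t≤ = begin
  s ^ suc d                                   ≤⟨ ^-monoˡ-≤ (suc d) s≤ ⟩
  (C * t ^ d) ^ suc d                         ≡⟨ ^-distribʳ-* (suc d) C (t ^ d) ⟩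
  C ^ suc d * (t ^ d) ^ suc d                 ≡⟨ cong (C ^ suc d *_) (^-swap t d (suc d)) ⟩
  C ^ suc d * (t ^ suc d) ^ d                 ≤⟨ *-monoʳ-≤ (C ^ suc d) (^-monoˡ-≤ d t≤) ⟩
  C ^ suc d * (K ^ suc d * n) ^ d             ≡⟨ cong (C ^ suc d *_) (^-distribʳ-* d (K ^ suc d) n) ⟩
  C ^ suc d * ((K ^ suc d) ^ d * n ^ d)       ≡⟨ *-assoc (C ^ suc d) _ (n ^ d) ⟨
  C ^ suc d * (K ^ suc d) ^ d * n ^ d         ≡⟨ cong (λ z → C ^ suc d * z * n ^ d) (^-swap K (suc d) d) ⟩
  C ^ suc d * (K ^ d) ^ suc d * n ^ d         ≡⟨ cong (_* n ^ d) (^-distribʳ-* (suc d) C (K ^ d)) ⟨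
  (C * K ^ d) ^ suc d * n ^ d                 ∎
  where open ≤-Reasoning

theorem2 : (d : ℕ) → .{{_ : NonZero d}} → f d =O[n^ d / suc d ]
theorem2 d = C * K ^ d , 1 , bound
  where
  -- This is the `K` of `sparse-powers` at h = 3, for which 4-minors are forbidden.
  K = 4 * 4
  C = proj₁ (sparse-powers 3 d)

  bound : ∀ n → 1 ≤ n → f d n ^ suc d ≤ (C * K ^ d) ^ suc d * n ^ d
  -- Powers of K^(d+1) are the sizes of the grids of side t = K^r, so t exceeds n^(1/(d+1)) by at
  -- most a factor K; this is the source of K^d in the constant.
  bound n 1≤n with power-above (^-monoʳ-< K (s≤s (s≤s z≤n)) {0} {suc d} (s≤s z≤n)) n 1≤n
  ... | r , n≤ , ≤n = bound-rescale {C = C} {K = K} {t = K ^ r} d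
    (f-bound {C = C} (proj₂ (sparse-powers 3 d) r) (subst (n ≤_) (^-swap K (suc d) r) n≤))
    (subst (_≤ K ^ suc d * n) (^-swap K (suc d) r) ≤n)
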